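{- Let $G$ be a bipartite permutation graph and let $M$ be a matching in $G$. The following are equivalent: (i) $M$ is uniquely restricted; (ii) there is no alternating cycle of length 4 with respect to $M$ in $G$; (iii) for any two edges $e,e'\in M$, $\{e,e'\}$ is a uniquely restricted matching in $G$.
   Context: Graphs are finite, simple, undirected. For a permutation $\pi$ of $\{1,\dots,n\}$, $G_\pi$ has vertex set $\{1,\dots,n\}$ and edges $ij$ with $(i-j)(\pi(i)-\pi(j))<0$; a permutation graph is a graph isomorphic to some $G_\pi$, and a bipartite permutation graph is a bipartite permutation graph. A matching is a set of pairwise vertex-disjoint edges; it is uniquely restricted if no other matching of $G$ matches exactly the same vertex set. An alternating cycle with respect to $M$ is an even cycle of $G$ in which every second edge belongs to $M$. -}

module Defs where

open import Data.Fin using (Fin; toℕ)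
open import Data.Fin.Permutation using (Permutation; Permutation′; _⟨$⟩ʳ_)
open import Data.Fin.Properties using (nonZeroIndex)
open import Data.Fin.Subset as Subset using (Subset; ⁅_⁆; ∁; Empty)
open import Data.Integer using (ℤ; +_; _-_; _*_; 0ℤ) renaming (_<_ to _<ℤ_)
open import Data.Integer.Properties using (_<?_; +-inverseʳ; <-irrefl)
open import Data.Integer.Tactic.RingSolver using (solve-∀)
open import Data.Nat using (ℕ; suc; _%_; _≤_)
open import Data.Nat.Divisibility using (_∣_)
open import Data.Product using (_×_; ∃; ∃₂)
open import Function.Bundles using (_⇔_)
open import Function.Definitions using (Injective)
open import Level using (0ℓ)
open import Relation.Binary using (Rel; Symmetric; Irreflexive) renaming (Decidable to Decidable₂)
open import Relation.Binary.PropositionalEquality using (_≡_; _≢_; refl; cong; subst)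
open import Relation.Nullary using (¬_)
open import Relation.Unary using (Pred; Decidable; _∈_; _≐_)

record Graph (n : ℕ) : Set₁ where
  field
    _~_      : Rel (Fin n) 0ℓ
    ~-sym    : Symmetric _~_
    ~-irrefl : Irreflexive _≡_ _~_
    _~?_     : Decidable₂ _~_

-- Vertices are numbered 0 … n-1 instead of 1 … n; only differences matter.
inversion : ∀ {n} → Permutation′ n → Fin n → Fin n → ℤ
inversion π i j =
  (+ toℕ i - + toℕ j) * (+ toℕ (π ⟨$⟩ʳ i) - + toℕ (π ⟨$⟩ʳ j))

private
  product-swap : ∀ (a b c d : ℤ) → (a - b) * (c - d) ≡ (b - a) * (d - c)
  product-swap = solve-∀

permutationGraph : ∀ {n} → Permutation′ n → Graph n
permutationGraph π = record
  { _~_      = λ i j → inversion π i j <ℤ 0ℤ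
  ; ~-sym    = λ {i} {j} → subst (_<ℤ 0ℤ)
                 (product-swap (+ toℕ i) (+ toℕ j) (+ toℕ (π ⟨$⟩ʳ i)) (+ toℕ (π ⟨$⟩ʳ j)))
  ; ~-irrefl = λ { {i} refl → <-irrefl
                 (cong (_* (+ toℕ (π ⟨$⟩ʳ i) - + toℕ (π ⟨$⟩ʳ i))) (+-inverseʳ (+ toℕ i))) }
  ; _~?_     = λ i j → inversion π i j <? 0ℤ
  }

_≅_ : ∀ {m n} → Graph m → Graph n → Set
_≅_ {m} {n} G H =
  ∃ λ (f : Permutation m n) → ∀ u v → (u G.~ v) ⇔ ((f ⟨$⟩ʳ u) H.~ (f ⟨$⟩ʳ v))
  where
  module G = Graph G
  module H = Graph H

IsPermutationGraph : ∀ {n} → Graph n → Set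
IsPermutationGraph G = ∃₂ λ m (π : Permutation′ m) → G ≅ permutationGraph π

module _ {n : ℕ} (G : Graph n) where
  open Graph G

  Independent : Subset n → Set
  Independent A = ∀ {u v} → u Subset.∈ A → v Subset.∈ A → ¬ (u ~ v)

  IsBipartite : Set
  IsBipartite = ∃ λ (A : Subset n) → Independent A × Independent (∁ A)

  IsBipartitePermutationGraph : Set
  IsBipartitePermutationGraph = IsBipartite × IsPermutationGraph G

-- The unordered pair {u , v}, as a set of vertices.
pair : ∀ {n} → Fin n → Fin n → Subset n
pair u v = ⁅ u ⁆ Subset.∪ ⁅ v ⁆

IsEdge : ∀ {n} → Graph n → Subset n → Set
IsEdge G e = ∃₂ λ u v → (u ~ v) × e ≡ pair u v
  where open Graph G

-- Being a subset of a finite set, a matching has decidable membership;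
-- constructively this has to be required.
record IsMatching {n} (G : Graph n) (M : Pred (Subset n) 0ℓ) : Set where
  field
    _∈?M     : Decidable M
    edges    : ∀ {e} → e ∈ M → IsEdge G e
    disjoint : ∀ {e e′} → e ∈ M → e′ ∈ M → e ≢ e′ → Empty (e Subset.∩ e′)

matchedVertices : ∀ {n} → Pred (Subset n) 0ℓ → Pred (Fin n) 0ℓ
matchedVertices M v = ∃ λ e → e ∈ M × v Subset.∈ e

UniquelyRestricted : ∀ {n} → Graph n → Pred (Subset n) 0ℓ → Set₁
UniquelyRestricted G M =
  ∀ N → IsMatching G N → matchedVertices N ≐ matchedVertices M → N ≐ M

-- j is the cyclic successor of i in 0, 1, …, k-1, 0.
Next : ∀ {k} → Fin k → Fin k → Set
Next {k} i j = toℕ j ≡ (suc (toℕ i) % k) {{nonZeroIndex i}}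

record Cycle {n} (G : Graph n) (k : ℕ) : Set where
  open Graph G
  field
    3≤k       : 3 ≤ k
    vertex    : Fin k → Fin n
    injective : Injective _≡_ _≡_ vertex
    adjacent  : ∀ {i j} → Next i j → vertex i ~ vertex j

-- The cycle is listed so that the edges leaving even positions lie in M, which
-- is no restriction: a cycle may be listed from any of its vertices.
record AlternatingCycle {n} (G : Graph n) (M : Pred (Subset n) 0ℓ) (k : ℕ) : Set where
  field
    cycle : Cycle G k
    even  : 2 ∣ k
  open Cycle cycle public
  field
    alternating : ∀ {i j} → Next i j → 2 ∣ toℕ i → pair (vertex i) (vertex j) ∈ M

{-# OPTIONS --safe #-}
-- In a drawing of a bipartite permutation graph every vertex is the upper left
-- end of all its edges or the lower right end of all of them, and two edges
-- whose ends come in opposite orders on the two sides span a 4-cycle.  So a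
-- matching M without alternating 4-cycle preserves the left-to-right order.
-- If N covers the same vertices, take the leftmost upper vertex u whose edge
-- u l of M is not in N, and follow N from u and from l: both lead to edges
-- of M lying to the right of u l, and one of these closes an alternating 4-cycle.
-- Conversely, flipping an alternating 4-cycle gives another matching.
module Submission where

open import Defs
import Data.Bool.Properties as Bool
open import Data.Empty using (⊥)
open import Data.Fin using (Fin) renaming (_<_ to _<ᶠ_)
open import Data.Fin.Induction using (<-wellFounded)
open import Data.Fin.Patterns using (0F; 1F; 2F; 3F)
open import Data.Fin.Permutation using (_⟨$⟩ʳ_)
import Data.Fin.Properties as Fin
open import Data.Fin.Subset as Subset using (Subset; ⁅_⁆)
open import Data.Fin.Subset.Properties
  using (_∈?_; x∈⁅x⁆; x∈⁅y⁆⇒x≡y; x∈p∪q⁺; x∈p∪q⁻; x∈p∩q⁺; x∈p∩q⁻; x∉p⇒x∈∁p; ∪-comm)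
open import Data.Integer using (ℤ; +_; 0ℤ; +<+; negative; nonNegative; nonPositive)
  renaming (_<_ to _<ℤ_; _-_ to _-ℤ_; _*_ to _*ℤ_; -_ to -ℤ_)
import Data.Integer.Properties as ℤ
open import Data.Nat using (ℕ; suc; _<_; s≤s; z≤n)
open import Data.Nat.Divisibility using (divides)
open import Data.Product using (_×_; _,_; proj₁; proj₂; ∃)
open import Data.Sum using (_⊎_; inj₁; inj₂) renaming (map to ⊎-map)
open import Data.Vec.Properties using (≡-dec)
open import Function using (_∘_)
open import Function.Bundles using (_⇔_; mk⇔; Equivalence; Injection)
open import Function.Definitions using (Injective)
open import Function.Properties.Inverse using (↔⇒↣)
open import Induction.WellFounded using (Acc; acc)
open import Level using (0ℓ)
open import Relation.Binary using (DecidableEquality; tri<; tri≈; tri>)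
open import Relation.Binary.PropositionalEquality
  using (_≡_; _≢_; refl; sym; trans; cong; subst)
open import Relation.Nullary using (¬_; yes; no; contradiction)
open import Relation.Nullary.Decidable using (decidable-stable; _×-dec_; _⊎-dec_; ¬?)
open import Relation.Unary using (Pred; Decidable; _∈_; _⊆_; _∪_; _≐_; ｛_｝)

-- Two-element vertex sets.

infix 4 _≟ˢ_
_≟ˢ_ : ∀ {n} → DecidableEquality (Subset n)
_≟ˢ_ = ≡-dec Bool._≟_

module _ {n : ℕ} {u v : Fin n} where

  ∈-pairˡ : u Subset.∈ pair u v
  ∈-pairˡ = x∈p∪q⁺ (inj₁ (x∈⁅x⁆ u))

  ∈-pairʳ : v Subset.∈ pair u v
  ∈-pairʳ = x∈p∪q⁺ (inj₂ (x∈⁅x⁆ v))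

  ∈-pair⁻ : ∀ {w} → w Subset.∈ pair u v → w ≡ u ⊎ w ≡ v
  ∈-pair⁻ = ⊎-map (x∈⁅y⁆⇒x≡y u) (x∈⁅y⁆⇒x≡y v) ∘ x∈p∪q⁻ ⁅ u ⁆ ⁅ v ⁆

pair-comm : ∀ {n} (u v : Fin n) → pair u v ≡ pair v u
pair-comm u v = ∪-comm ⁅ u ⁆ ⁅ v ⁆

-- Pairs may be degenerate: if `v` is `u`, the left side is a singleton, which forces `w` to be `u`
-- as well.
pair-cancelˡ : ∀ {n} {u v w : Fin n} → pair u v ≡ pair u w → v ≡ w
pair-cancelˡ eq with ∈-pair⁻ (subst (_ Subset.∈_) eq ∈-pairʳ)
... | inj₂ v≡w  = v≡w
... | inj₁ refl with ∈-pair⁻ (subst (_ Subset.∈_) (sym eq) ∈-pairʳ)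
...   | inj₁ w≡u = sym w≡u
...   | inj₂ w≡u = sym w≡u

-- Matchings and partners.

module _ {n : ℕ} {G : Graph n} where
  open Graph G

  ~⇒≢ : ∀ {u v} → u ~ v → u ≢ v
  ~⇒≢ u~v u≡v = ~-irrefl u≡v u~v

  isMatching : ∀ {M : Pred (Subset n) 0ℓ} → Decidable M → (∀ {e} → e ∈ M → IsEdge G e) →
    (∀ {e e′ v} → e ∈ M → e′ ∈ M → v Subset.∈ e → v Subset.∈ e′ → e ≡ e′) → IsMatching G M
  isMatching M? edges same = record
    { _∈?M     = M?
    ; edges    = edges
    ; disjoint = λ {e} {e′} e∈M e′∈M e≢e′ (v , v∈) →
        let v∈e , v∈e′ = x∈p∩q⁻ e e′ v∈ in e≢e′ (same e∈M e′∈M v∈e v∈e′)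
    }

module Matching {n : ℕ} {G : Graph n} {M : Pred (Subset n) 0ℓ} (isM : IsMatching G M) where
  open Graph G
  open IsMatching isM public

  -- The contrapositive of `disjoint`, available constructively because equality of vertex sets is
  -- decidable.
  same-edge : ∀ {e e′ v} → e ∈ M → e′ ∈ M → v Subset.∈ e → v Subset.∈ e′ → e ≡ e′
  same-edge e∈M e′∈M v∈e v∈e′ = decidable-stable (_ ≟ˢ _)
    λ e≢e′ → disjoint e∈M e′∈M e≢e′ (_ , x∈p∩q⁺ (v∈e , v∈e′))

  adjacent : ∀ {u v} → pair u v ∈ M → u ~ v
  adjacent {u} {v} uv∈M with edges uv∈M
  ... | a , b , a~b , eq with ∈-pair⁻ (subst (u Subset.∈_) eq ∈-pairˡ)
  ...   | inj₁ refl = subst (u ~_) (pair-cancelˡ (sym eq)) a~b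
  ...   | inj₂ refl = subst (u ~_) (pair-cancelˡ (trans (pair-comm u a) (sym eq))) (~-sym a~b)

  partner-uniqueʳ : ∀ {u v w} → pair u v ∈ M → pair u w ∈ M → v ≡ w
  partner-uniqueʳ uv∈M uw∈M = pair-cancelˡ (same-edge uv∈M uw∈M ∈-pairˡ ∈-pairˡ)

  partner-uniqueˡ : ∀ {u v w} → pair v u ∈ M → pair w u ∈ M → v ≡ w
  partner-uniqueˡ vu∈M wu∈M =
    partner-uniqueʳ (subst M (pair-comm _ _) vu∈M) (subst M (pair-comm _ _) wu∈M)

  partner : ∀ {v} → v ∈ matchedVertices M → ∃ λ w → v ~ w × pair v w ∈ M
  partner (e , e∈M , v∈e) with edges e∈M
  ... | a , b , a~b , refl with ∈-pair⁻ v∈e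
  ...   | inj₁ refl = b , a~b , e∈M
  ...   | inj₂ refl = a , ~-sym a~b , subst M (pair-comm a b) e∈M

  submatching : ∀ {L : Pred (Subset n) 0ℓ} → Decidable L → L ⊆ M → IsMatching G L
  submatching L? L⊆M = isMatching L? (edges ∘ L⊆M) λ e∈L e′∈L → same-edge (L⊆M e∈L) (L⊆M e′∈L)

-- Alternating 4-cycles in terms of their four corners.

record AlternatingSquare {n} (G : Graph n) (M : Pred (Subset n) 0ℓ) : Set where
  open Graph G
  field
    {a b c d} : Fin n
    ab∈M : pair a b ∈ M
    b~c  : b ~ c
    cd∈M : pair c d ∈ M
    d~a  : d ~ a
    -- Only the diagonals are listed as distinct: when `M` is a matching, consecutive corners are
    -- adjacent and so differ by irreflexivity.
    a≢c  : a ≢ c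
    b≢d  : b ≢ d

module _ {n : ℕ} {G : Graph n} {M : Pred (Subset n) 0ℓ} where
  open Graph G

  cycle⇒square : AlternatingCycle G M 4 → AlternatingSquare G M
  cycle⇒square C = record
    { ab∈M = alternating {0F} {1F} refl (divides 0 refl)
    ; b~c  = adjacent {1F} {2F} refl
    ; cd∈M = alternating {2F} {3F} refl (divides 1 refl)
    ; d~a  = adjacent {3F} {0F} refl
    ; a≢c  = λ eq → contradiction (injective {0F} {2F} eq) λ ()
    ; b≢d  = λ eq → contradiction (injective {1F} {3F} eq) λ ()
    }
    where open AlternatingCycle C

  square⇒cycle : IsMatching G M → AlternatingSquare G M → AlternatingCycle G M 4
  square⇒cycle isM S = record
    { cycle = record
      { 3≤k       = s≤s (s≤s (s≤s z≤n))
      ; vertex    = vertex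
      ; injective = λ {i} {j} → injective i j
      ; adjacent  = λ {i} {j} → adjacent i j
      }
    ; even        = divides 2 refl
    ; alternating = λ {i} {j} → alternating i j
    }
    where
    open AlternatingSquare S
    module M = Matching isM

    a~b : a ~ b
    a~b = M.adjacent ab∈M
    c~d : c ~ d
    c~d = M.adjacent cd∈M

    vertex : Fin 4 → Fin n
    vertex 0F = a
    vertex 1F = b
    vertex 2F = c
    vertex 3F = d

    injective : ∀ i j → vertex i ≡ vertex j → i ≡ j
    injective 0F 0F _  = refl
    injective 0F 1F eq = contradiction eq (~⇒≢ {G = G} a~b)
    injective 0F 2F eq = contradiction eq a≢c
    injective 0F 3F eq = contradiction (sym eq) (~⇒≢ {G = G} d~a)
    injective 1F 0F eq = contradiction (sym eq) (~⇒≢ {G = G} a~b)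
    injective 1F 1F _  = refl
    injective 1F 2F eq = contradiction eq (~⇒≢ {G = G} b~c)
    injective 1F 3F eq = contradiction eq b≢d
    injective 2F 0F eq = contradiction (sym eq) a≢c
    injective 2F 1F eq = contradiction (sym eq) (~⇒≢ {G = G} b~c)
    injective 2F 2F _  = refl
    injective 2F 3F eq = contradiction eq (~⇒≢ {G = G} c~d)
    injective 3F 0F eq = contradiction eq (~⇒≢ {G = G} d~a)
    injective 3F 1F eq = contradiction (sym eq) b≢d
    injective 3F 2F eq = contradiction (sym eq) (~⇒≢ {G = G} c~d)
    injective 3F 3F _  = refl

    adjacent : ∀ i j → Next i j → vertex i ~ vertex j
    adjacent 0F 1F _ = a~b
    adjacent 1F 2F _ = b~c
    adjacent 2F 3F _ = c~d
    adjacent 3F 0F _ = d~a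

    alternating : ∀ i j → Next i j → _ → pair (vertex i) (vertex j) ∈ M
    alternating 0F 1F _ _ = ab∈M
    -- Edges leaving odd positions: neither 1 nor 3 is twice any quotient.
    alternating 1F 2F _ (divides 0 ())
    alternating 1F 2F _ (divides (suc _) ())
    alternating 2F 3F _ _ = cd∈M
    alternating 3F 0F _ (divides 0 ())
    alternating 3F 0F _ (divides 1 ())
    alternating 3F 0F _ (divides (suc (suc _)) ())

-- Exchanging the edges of an alternating square.

module Flip {n : ℕ} {G : Graph n} {M : Pred (Subset n) 0ℓ}
            (isM : IsMatching G M) (S : AlternatingSquare G M) where
  open Graph G
  open Matching isM
  open AlternatingSquare S

  Old New Flipped : Pred (Subset n) 0ℓ
  Old e = e ∈ M × e ≢ pair a b × e ≢ pair c d
  New e = e ≡ pair b c ⊎ e ≡ pair d a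
  Flipped = Old ∪ New

  flipped? : Decidable Flipped
  flipped? e = (e ∈?M ×-dec ¬? (e ≟ˢ pair a b) ×-dec ¬? (e ≟ˢ pair c d))
               ⊎-dec (e ≟ˢ pair b c ⊎-dec e ≟ˢ pair d a)

  -- Every corner is matched in `M` by `ab` or `cd`, so an edge of `M` through a corner is one of
  -- the two removed edges.
  old-new-disjoint : ∀ {e e′ v} → e ∈ Old → e′ ∈ New → v Subset.∈ e → v Subset.∈ e′ → ⊥
  old-new-disjoint (e∈M , e≢ab , e≢cd) (inj₁ refl) v∈e v∈bc with ∈-pair⁻ v∈bc
  ... | inj₁ refl = e≢ab (same-edge e∈M ab∈M v∈e ∈-pairʳ)
  ... | inj₂ refl = e≢cd (same-edge e∈M cd∈M v∈e ∈-pairˡ)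
  old-new-disjoint (e∈M , e≢ab , e≢cd) (inj₂ refl) v∈e v∈da with ∈-pair⁻ v∈da
  ... | inj₁ refl = e≢cd (same-edge e∈M cd∈M v∈e ∈-pairʳ)
  ... | inj₂ refl = e≢ab (same-edge e∈M ab∈M v∈e ∈-pairˡ)

  bc-da-disjoint : ∀ {v} → v Subset.∈ pair b c → v Subset.∈ pair d a → ⊥
  bc-da-disjoint v∈bc v∈da with ∈-pair⁻ v∈bc | ∈-pair⁻ v∈da
  ... | inj₁ refl | inj₁ b≡d = b≢d b≡d
  ... | inj₁ refl | inj₂ b≡a = ~-irrefl (sym b≡a) (adjacent ab∈M)
  ... | inj₂ refl | inj₁ c≡d = ~-irrefl c≡d (adjacent cd∈M)
  ... | inj₂ refl | inj₂ c≡a = a≢c (sym c≡a)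

  flipped-same-edge : ∀ {e e′ v} → e ∈ Flipped → e′ ∈ Flipped →
    v Subset.∈ e → v Subset.∈ e′ → e ≡ e′
  flipped-same-edge (inj₁ (e∈M , _)) (inj₁ (e′∈M , _)) v∈e v∈e′ = same-edge e∈M e′∈M v∈e v∈e′
  flipped-same-edge (inj₁ old) (inj₂ new) v∈e v∈e′ =
    contradiction v∈e′ (old-new-disjoint old new v∈e)
  flipped-same-edge (inj₂ new) (inj₁ old) v∈e v∈e′ =
    contradiction v∈e (old-new-disjoint old new v∈e′)
  flipped-same-edge (inj₂ (inj₁ refl)) (inj₂ (inj₁ refl)) _ _ = refl
  flipped-same-edge (inj₂ (inj₁ refl)) (inj₂ (inj₂ refl)) v∈bc v∈da =
    contradiction v∈da (bc-da-disjoint v∈bc)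
  flipped-same-edge (inj₂ (inj₂ refl)) (inj₂ (inj₁ refl)) v∈da v∈bc =
    contradiction v∈da (bc-da-disjoint v∈bc)
  flipped-same-edge (inj₂ (inj₂ refl)) (inj₂ (inj₂ refl)) _ _ = refl

  flipped-edges : ∀ {e} → e ∈ Flipped → IsEdge G e
  flipped-edges (inj₁ (e∈M , _))     = edges e∈M
  flipped-edges (inj₂ (inj₁ e≡bc)) = b , c , b~c , e≡bc
  flipped-edges (inj₂ (inj₂ e≡da)) = d , a , d~a , e≡da

  flipped-isMatching : IsMatching G Flipped
  flipped-isMatching = isMatching {G = G} flipped? flipped-edges flipped-same-edge

  -- The removed and the added edges cover the same four corners.
  flipped-matches⇒ : matchedVertices Flipped ⊆ matchedVertices M
  flipped-matches⇒ (e , inj₁ (e∈M , _) , v∈e) = e , e∈M , v∈e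
  flipped-matches⇒ (_ , inj₂ (inj₁ refl) , v∈bc) with ∈-pair⁻ v∈bc
  ... | inj₁ refl = _ , ab∈M , ∈-pairʳ
  ... | inj₂ refl = _ , cd∈M , ∈-pairˡ
  flipped-matches⇒ (_ , inj₂ (inj₂ refl) , v∈da) with ∈-pair⁻ v∈da
  ... | inj₁ refl = _ , cd∈M , ∈-pairʳ
  ... | inj₂ refl = _ , ab∈M , ∈-pairˡ

  flipped-matches⇐ : matchedVertices M ⊆ matchedVertices Flipped
  flipped-matches⇐ (e , e∈M , v∈e) with e ≟ˢ pair a b | e ≟ˢ pair c d
  ... | no e≢ab  | no e≢cd = e , inj₁ (e∈M , e≢ab , e≢cd) , v∈e
  ... | yes refl | _ with ∈-pair⁻ v∈e
  ...   | inj₁ refl = _ , inj₂ (inj₂ refl) , ∈-pairʳ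
  ...   | inj₂ refl = _ , inj₂ (inj₁ refl) , ∈-pairˡ
  flipped-matches⇐ (e , e∈M , v∈e) | no _ | yes refl with ∈-pair⁻ v∈e
  ...   | inj₁ refl = _ , inj₂ (inj₁ refl) , ∈-pairʳ
  ...   | inj₂ refl = _ , inj₂ (inj₂ refl) , ∈-pairˡ

  -- Uniqueness would put `bc` into `M` beside `ab`, giving `b` the two partners `a` and `c`.
  ¬uniquelyRestricted : ¬ UniquelyRestricted G M
  ¬uniquelyRestricted unique = a≢c (partner-uniqueˡ ab∈M cb∈M)
    where
    bc∈M : pair b c ∈ M
    bc∈M = proj₁ (unique Flipped flipped-isMatching (flipped-matches⇒ , flipped-matches⇐))
                 (inj₂ (inj₁ refl))
    cb∈M : pair c b ∈ M
    cb∈M = subst M (pair-comm b c) bc∈M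

-- Signs of differences and of their products.

i<j⇒i-j<0 : ∀ {i j} → i <ℤ j → i -ℤ j <ℤ 0ℤ
i<j⇒i-j<0 {i} {j} i<j = subst (i -ℤ j <ℤ_) (ℤ.+-inverseʳ j) (ℤ.+-monoˡ-< (-ℤ j) i<j)

i<j⇒0<j-i : ∀ {i j} → i <ℤ j → 0ℤ <ℤ j -ℤ i
i<j⇒0<j-i {i} {j} i<j = subst (_<ℤ j -ℤ i) (ℤ.+-inverseʳ i) (ℤ.+-monoˡ-< (-ℤ i) i<j)

i-j<0⇒i<j : ∀ {i j} → i -ℤ j <ℤ 0ℤ → i <ℤ j
i-j<0⇒i<j {i} {j} i-j<0 with ℤ.<-cmp i j
... | tri< i<j _ _  = i<j
... | tri≈ _ refl _ = contradiction i-j<0 (ℤ.<-irrefl (ℤ.+-inverseʳ i))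
... | tri> _ _ j<i  = contradiction i-j<0 (ℤ.<-asym (i<j⇒0<j-i j<i))

0<i-j⇒j<i : ∀ {i j} → 0ℤ <ℤ i -ℤ j → j <ℤ i
0<i-j⇒j<i {i} {j} 0<i-j with ℤ.<-cmp i j
... | tri< i<j _ _  = contradiction 0<i-j (ℤ.<-asym (i<j⇒i-j<0 i<j))
... | tri≈ _ refl _ = contradiction 0<i-j (ℤ.<-irrefl (sym (ℤ.+-inverseʳ i)))
... | tri> _ _ j<i  = j<i

opposite⇒*<0 : ∀ {i j k l} → i <ℤ j → l <ℤ k → (i -ℤ j) *ℤ (k -ℤ l) <ℤ 0ℤ
opposite⇒*<0 {i} {j} {k} {l} i<j l<k =
  subst ((i -ℤ j) *ℤ (k -ℤ l) <ℤ_) (ℤ.*-zeroʳ (i -ℤ j))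
    (ℤ.*-monoˡ-<-neg (i -ℤ j) {{negative (i<j⇒i-j<0 i<j)}} (i<j⇒0<j-i l<k))

-- Comparing `i` with `j` fixes the sign of the first factor. With 0 written as that factor times 0,
-- the factor cancels and its sign gives the direction of the remaining inequality.
*<0⇒opposite : ∀ {i j k l} → (i -ℤ j) *ℤ (k -ℤ l) <ℤ 0ℤ →
  (i <ℤ j × l <ℤ k) ⊎ (j <ℤ i × k <ℤ l)
*<0⇒opposite {i} {j} {k} {l} p<0 with ℤ.<-cmp i j
... | tri< i<j _ _ = inj₁ (i<j , 0<i-j⇒j<i (ℤ.*-cancelˡ-<-nonPos (i -ℤ j)
        {{nonPositive (ℤ.<⇒≤ (i<j⇒i-j<0 i<j))}} p<[i-j]*0))
  where p<[i-j]*0 = subst ((i -ℤ j) *ℤ (k -ℤ l) <ℤ_) (sym (ℤ.*-zeroʳ (i -ℤ j))) p<0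
... | tri≈ _ refl _ = contradiction p<0 (ℤ.<-irrefl (cong (_*ℤ (k -ℤ l)) (ℤ.+-inverseʳ i)))
... | tri> _ _ j<i = inj₂ (j<i , i-j<0⇒i<j (ℤ.*-cancelˡ-<-nonNeg (i -ℤ j)
        {{nonNegative (ℤ.<⇒≤ (i<j⇒0<j-i j<i))}} p<[i-j]*0))
  where p<[i-j]*0 = subst ((i -ℤ j) *ℤ (k -ℤ l) <ℤ_) (sym (ℤ.*-zeroʳ (i -ℤ j))) p<0

-- Triangle-freeness and drawings of permutation graphs.

IsTriangleFree : ∀ {n} → Graph n → Set
IsTriangleFree G = ∀ {u v w} → u ~ v → v ~ w → ¬ (u ~ w)
  where open Graph G

-- Two of any three vertices lie in the same class.
bipartite⇒triangle-free : ∀ {n} (G : Graph n) → IsBipartite G → IsTriangleFree G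
bipartite⇒triangle-free G (A , indA , ind∁A) {u} {v} {w} u~v v~w u~w with v ∈? A
... | yes v∈A = ind∁A (x∉p⇒x∈∁p λ u∈A → indA u∈A v∈A u~v)
                      (x∉p⇒x∈∁p λ w∈A → indA v∈A w∈A v~w) u~w
... | no v∉A with u ∈? A | w ∈? A
...   | yes u∈A | yes w∈A = indA u∈A w∈A u~w
...   | no u∉A  | _       = ind∁A (x∉p⇒x∈∁p u∉A) (x∉p⇒x∈∁p v∉A) u~v
...   | _       | no w∉A  = ind∁A (x∉p⇒x∈∁p v∉A) (x∉p⇒x∈∁p w∉A) v~w

-- Vertices are points of a grid, for a permutation graph its points (position, image). The relation
-- `◁` orients each edge from its upper left to its lower right end.
record Drawing {n} (G : Graph n) : Set where
  open Graph G
  infix 4 _◁_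
  field
    {size}      : ℕ
    x y         : Fin n → Fin size
    x-injective : Injective _≡_ _≡_ x
    y-injective : Injective _≡_ _≡_ y

  _◁_ : Fin n → Fin n → Set
  u ◁ v = x u <ᶠ x v × y v <ᶠ y u

  field
    ~⇒◁ : ∀ {u v} → u ~ v → u ◁ v ⊎ v ◁ u
    ◁⇒~ : ∀ {u v} → u ◁ v → u ~ v

permutation-drawing : ∀ {n} {G : Graph n} → IsPermutationGraph G → Drawing G
permutation-drawing {n} {G} (m , π , f , f-iso) = record
  { x           = x
  ; y           = y
  ; x-injective = Injection.injective (↔⇒↣ f)
  ; y-injective = Injection.injective (↔⇒↣ f) ∘ Injection.injective (↔⇒↣ π)
  ; ~⇒◁         = λ {u} {v} u~v →
      ⊎-map drop-+ drop-+ (*<0⇒opposite (Equivalence.to (f-iso u v) u~v))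
  ; ◁⇒~         = λ {u} {v} (xu<xv , yv<yu) →
      Equivalence.from (f-iso u v) (opposite⇒*<0 (+<+ xu<xv) (+<+ yv<yu))
  }
  where
  x y : Fin n → Fin m
  x u = f ⟨$⟩ʳ u
  y u = π ⟨$⟩ʳ x u

  drop-+ : ∀ {a b c d} → + a <ℤ + b × + c <ℤ + d → a < b × c < d
  drop-+ (+<+ a<b , +<+ c<d) = a<b , c<d

-- Geometry of triangle-free drawings.

module TriangleFreeDrawing {n : ℕ} {G : Graph n} (drawing : Drawing G)
  (triangle-free : IsTriangleFree G) where
  open Graph G
  open Drawing drawing

  -- Since `◁` is transitive, a chain of two edges closes to a triangle. Hence no vertex is the
  -- upper end of one edge and the lower end of another.
  ◁-chain-free : ∀ {u v w} → u ◁ v → ¬ (v ◁ w)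
  ◁-chain-free u◁v@(xu<xv , yv<yu) v◁w@(xv<xw , yw<yv) =
    triangle-free (◁⇒~ u◁v) (◁⇒~ v◁w) (◁⇒~ (Fin.<-trans xu<xv xv<xw , Fin.<-trans yw<yv yv<yu))

  not-left⇒right : ∀ {u u′} → u ≢ u′ → ¬ (x u′ <ᶠ x u) → x u <ᶠ x u′
  not-left⇒right {u} {u′} u≢u′ u′≮u with Fin.<-cmp (x u) (x u′)
  ... | tri< u<u′ _ _ = u<u′
  ... | tri≈ _ eq _   = contradiction (x-injective eq) u≢u′
  ... | tri> _ _ u′<u = contradiction u′<u u′≮u

  -- Otherwise `u ◁ u′ ◁ l′` would be a chain.
  upper-monotone : ∀ {u u′ l′} → u′ ◁ l′ → x u <ᶠ x u′ → y u <ᶠ y u′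
  upper-monotone {u} {u′} u′◁l′ xu<xu′ with Fin.<-cmp (y u) (y u′)
  ... | tri< yu<yu′ _ _ = yu<yu′
  ... | tri≈ _ yu≡yu′ _ = contradiction xu<xu′ (Fin.<-irrefl (cong x (y-injective yu≡yu′)))
  ... | tri> _ _ yu′<yu = contradiction u′◁l′ (◁-chain-free (xu<xu′ , yu′<yu))

  lower-monotone : ∀ {u l l′} → u ◁ l → x l <ᶠ x l′ → y l <ᶠ y l′
  lower-monotone {l = l} {l′} u◁l xl<xl′ with Fin.<-cmp (y l) (y l′)
  ... | tri< yl<yl′ _ _ = yl<yl′
  ... | tri≈ _ yl≡yl′ _ = contradiction xl<xl′ (Fin.<-irrefl (cong x (y-injective yl≡yl′)))
  ... | tri> _ _ yl′<yl = contradiction (xl<xl′ , yl′<yl) (◁-chain-free u◁l)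

  -- The `x`-order is `u`, `u′`, `l′`, `l`, and by monotonicity the increasing `y`-order is `l′`,
  -- `l`, `u`, `u′`. So both upper vertices lie left of and above both lower ones.
  uncross : ∀ {u u′ l l′} → u ◁ l → u′ ◁ l′ → x u <ᶠ x u′ → x l′ <ᶠ x l → u ◁ l′ × u′ ◁ l
  uncross (_ , yl<yu) u′◁l′@(xu′<xl′ , _) xu<xu′ xl′<xl =
    (Fin.<-trans xu<xu′ xu′<xl′ , Fin.<-trans (lower-monotone u′◁l′ xl′<xl) yl<yu) ,
    (Fin.<-trans xu′<xl′ xl′<xl , Fin.<-trans yl<yu (upper-monotone u′◁l′ xu<xu′))

  module _ {M : Pred (Subset n) 0ℓ} (isM : IsMatching G M) where
    open Matching isM using (partner)

    -- The edge `u ◁ l` marks `u` as an upper vertex: a partner on its upper left would create a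
    -- chain.
    upper-partner : ∀ {u l} → u ◁ l → u ∈ matchedVertices M → ∃ λ l′ → u ◁ l′ × pair u l′ ∈ M
    upper-partner u◁l u∈M with partner u∈M
    ... | l′ , u~l′ , ul′∈M with ~⇒◁ u~l′
    ...   | inj₁ u◁l′ = l′ , u◁l′ , ul′∈M
    ...   | inj₂ l′◁u = contradiction u◁l (◁-chain-free l′◁u)

    lower-partner : ∀ {u l} → u ◁ l → l ∈ matchedVertices M → ∃ λ u′ → u′ ◁ l × pair u′ l ∈ M
    lower-partner u◁l l∈M with partner l∈M
    ... | u′ , l~u′ , lu′∈M with ~⇒◁ l~u′
    ...   | inj₁ l◁u′ = contradiction l◁u′ (◁-chain-free u◁l)
    ...   | inj₂ u′◁l = u′ , u′◁l , subst M (pair-comm _ _) lu′∈M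

  -- Uniqueness for matchings without alternating squares.

  module SquareFree {M : Pred (Subset n) 0ℓ} (isM : IsMatching G M)
                    (square-free : ¬ AlternatingSquare G M) where
    module M = Matching isM

    no-square : ∀ {u u′ l l′} → pair u l ∈ M → pair u′ l′ ∈ M → u ≢ u′ →
      u ◁ l′ → ¬ (u′ ◁ l)
    no-square {u} {u′} {l} {l′} ul∈M u′l′∈M u≢u′ u◁l′ u′◁l = square-free record
      { ab∈M = ul∈M
      ; b~c  = ~-sym (◁⇒~ u′◁l)
      ; cd∈M = u′l′∈M
      ; d~a  = ~-sym (◁⇒~ u◁l′)
      ; a≢c  = u≢u′
      ; b≢d  = λ { refl → u≢u′ (M.partner-uniqueˡ ul∈M u′l′∈M) }
      }

    -- If the lower ends came in the opposite order, `uncross` would supply the two edges that close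
    -- an alternating square.
    monotone : ∀ {u u′ l l′} → u ◁ l → u′ ◁ l′ → pair u l ∈ M → pair u′ l′ ∈ M →
      x u <ᶠ x u′ → x l <ᶠ x l′
    monotone {l = l} {l′} u◁l u′◁l′ ul∈M u′l′∈M xu<xu′ with Fin.<-cmp (x l) (x l′)
    ... | tri< xl<xl′ _ _ = xl<xl′
    ... | tri≈ _ xl≡xl′ _ with refl ← x-injective xl≡xl′ =
      contradiction xu<xu′ (Fin.<-irrefl (cong x (M.partner-uniqueˡ ul∈M u′l′∈M)))
    ... | tri> _ _ xl′<xl =
      let u◁l′ , u′◁l = uncross u◁l u′◁l′ xu<xu′ xl′<xl
          u≢u′ = λ u≡u′ → Fin.<-irrefl (cong x u≡u′) xu<xu′
      in contradiction u′◁l (no-square ul∈M u′l′∈M u≢u′ u◁l′)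

    module _ {N : Pred (Subset n) 0ℓ} (isN : IsMatching G N)
             (cover : matchedVertices N ≐ matchedVertices M) where
      module N = Matching isN

      -- The choice of a leftmost `u` becomes well-founded induction on `x u`: `rec` keeps every
      -- edge of `M` whose upper end lies further left.
      ◁-edge-kept : ∀ {u l} → Acc _<ᶠ_ (x u) → u ◁ l → pair u l ∈ M → pair u l ∈ N
      ◁-edge-kept {u} {l} (acc rec) u◁l ul∈M = decidable-stable (_ N.∈?M) not-lost
        where
        not-lost : ¬ ¬ (pair u l ∈ N)
        -- This builds the walk `u′ l′ u l u″ l″`, whose edges lie alternately in `M` and `N`,
        -- starting and ending with `M`.
        not-lost ul∉N
          with l′ , u◁l′ , ul′∈N ← upper-partner isN u◁l (proj₂ cover (_ , ul∈M , ∈-pairˡ))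
          with u′ , u′◁l′ , u′l′∈M ← lower-partner isM u◁l′ (proj₁ cover (_ , ul′∈N , ∈-pairʳ))
          with u″ , u″◁l , u″l∈N ← lower-partner isN u◁l (proj₂ cover (_ , ul∈M , ∈-pairʳ))
          with l″ , u″◁l″ , u″l″∈M ← upper-partner isM u″◁l (proj₁ cover (_ , u″l∈N , ∈-pairˡ))
          = compare
          where
          u≢u′ : u ≢ u′
          u≢u′ refl with refl ← M.partner-uniqueʳ ul∈M u′l′∈M = ul∉N ul′∈N

          u≢u″ : u ≢ u″
          u≢u″ refl = ul∉N u″l∈N

          u<u′ : x u <ᶠ x u′
          -- Were `u′` further left, induction would put `u′l′` into `N`, where `l′` already has the
          -- partner `u`.
          u<u′ = not-left⇒right u≢u′ λ u′<u →
            u≢u′ (N.partner-uniqueˡ ul′∈N (◁-edge-kept (rec u′<u) u′◁l′ u′l′∈M))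

          l″≢l : l″ ≢ l
          l″≢l refl = u≢u″ (M.partner-uniqueˡ ul∈M u″l″∈M)

          u<u″ : x u <ᶠ x u″
          -- Likewise `u″l″` would be in `N`, where `u″` already has the partner `l`.
          u<u″ = not-left⇒right u≢u″ λ u″<u →
            l″≢l (N.partner-uniqueʳ (◁-edge-kept (rec u″<u) u″◁l″ u″l″∈M) u″l∈N)

          compare : ⊥
          compare with Fin.<-cmp (x u′) (x u″)
          -- By `monotone`, `l` lies left of `l′`, so the `N`-edge `u″l` crosses `u′l′`. Uncrossing
          -- yields `u′ ◁ l`, and `u`, `l`, `u′`, `l′` form a square.
          ... | tri< u′<u″ _ _ = no-square ul∈M u′l′∈M u≢u′ u◁l′
            (proj₁ (uncross u′◁l′ u″◁l u′<u″ (monotone u◁l u′◁l′ ul∈M u′l′∈M u<u′)))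
          ... | tri≈ _ eq _ with refl ← x-injective eq =
            no-square ul∈M u′l′∈M u≢u′ u◁l′ u″◁l
          -- Now `l″` lies left of `l′`, so uncrossing `ul′` and `u″l″` yields `u ◁ l″`; with
          -- `u″ ◁ l` this closes a square on `ul` and `u″l″`.
          ... | tri> _ _ u″<u′ = no-square ul∈M u″l″∈M u≢u″
            (proj₁ (uncross u◁l′ u″◁l″ u<u″ (monotone u″◁l″ u′◁l′ u″l″∈M u′l′∈M u″<u′))) u″◁l

      edges-kept : M ⊆ N
      edges-kept e∈M with M.edges e∈M
      ... | u , v , u~v , refl with ~⇒◁ u~v
      ...   | inj₁ u◁v = ◁-edge-kept (<-wellFounded _) u◁v e∈M
      ...   | inj₂ v◁u = subst N (pair-comm v u)
        (◁-edge-kept (<-wellFounded _) v◁u (subst M (pair-comm u v) e∈M))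

      -- An end of an edge of `N` is covered by some edge of `M`. That edge is also in `N`, so the
      -- two coincide.
      no-new-edges : N ⊆ M
      no-new-edges e∈N with N.edges e∈N
      ... | u , v , u~v , refl with proj₁ cover (_ , e∈N , ∈-pairˡ)
      ...   | e′ , e′∈M , u∈e′ =
        subst M (N.same-edge (edges-kept e′∈M) e∈N u∈e′ ∈-pairˡ) e′∈M

    uniquelyRestricted : UniquelyRestricted G M
    uniquelyRestricted N isN cover = no-new-edges isN cover , edges-kept isN cover

-- The equivalences, for the whole matching and for its pairs of edges.

module _ {n : ℕ} {G : Graph n} {M : Pred (Subset n) 0ℓ} (isM : IsMatching G M) where

  UR⇒no-alternating-C₄ : UniquelyRestricted G M → ¬ AlternatingCycle G M 4
  UR⇒no-alternating-C₄ unique C = Flip.¬uniquelyRestricted isM (cycle⇒square C) unique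

  no-alternating-C₄⇒UR : IsBipartitePermutationGraph G → ¬ AlternatingCycle G M 4 →
    UniquelyRestricted G M
  no-alternating-C₄⇒UR (bipartite , permutation) no-C₄ =
    TriangleFreeDrawing.SquareFree.uniquelyRestricted
      (permutation-drawing {G = G} permutation) (bipartite⇒triangle-free G bipartite)
      isM (no-C₄ ∘ square⇒cycle isM)

｛｝∪｛｝⊆ : ∀ {n} {M : Pred (Subset n) 0ℓ} {e e′} → e ∈ M → e′ ∈ M → ｛ e ｝ ∪ ｛ e′ ｝ ⊆ M
｛｝∪｛｝⊆ e∈M e′∈M (inj₁ refl) = e∈M
｛｝∪｛｝⊆ e∈M e′∈M (inj₂ refl) = e′∈M

AlternatingSquare-mono : ∀ {n} {G : Graph n} {L M : Pred (Subset n) 0ℓ} → L ⊆ M →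
  AlternatingSquare G L → AlternatingSquare G M
AlternatingSquare-mono L⊆M S = record
  { ab∈M = L⊆M ab∈M ; b~c = b~c ; cd∈M = L⊆M cd∈M ; d~a = d~a ; a≢c = a≢c ; b≢d = b≢d }
  where open AlternatingSquare S

theorem5 : ∀ {n : ℕ} (G : Graph n) → IsBipartitePermutationGraph G →
    (M : Pred (Subset n) 0ℓ) → IsMatching G M →
    (UniquelyRestricted G M ⇔ (¬ AlternatingCycle G M 4))
    × ((¬ AlternatingCycle G M 4) ⇔
       (∀ e e′ → e ∈ M → e′ ∈ M → e ≢ e′ →
         IsMatching G (｛ e ｝ ∪ ｛ e′ ｝) × UniquelyRestricted G (｛ e ｝ ∪ ｛ e′ ｝)))
theorem5 {n} G bpg M isM =
  mk⇔ (UR⇒no-alternating-C₄ isM) (no-alternating-C₄⇒UR isM bpg) , mk⇔ pairs-restricted no-C₄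
  where
  pairs-restricted : ¬ AlternatingCycle G M 4 → ∀ e e′ → e ∈ M → e′ ∈ M → e ≢ e′ →
    IsMatching G (｛ e ｝ ∪ ｛ e′ ｝) × UniquelyRestricted G (｛ e ｝ ∪ ｛ e′ ｝)
  -- An alternating 4-cycle for the two edges alone is also one for `M`.
  pairs-restricted no-C₄ e e′ e∈M e′∈M _ = isL , no-alternating-C₄⇒UR isL bpg
    (no-C₄ ∘ square⇒cycle isM ∘ AlternatingSquare-mono L⊆M ∘ cycle⇒square)
    where
    L⊆M : ｛ e ｝ ∪ ｛ e′ ｝ ⊆ M
    L⊆M = ｛｝∪｛｝⊆ e∈M e′∈M
    isL : IsMatching G (｛ e ｝ ∪ ｛ e′ ｝)
    isL = Matching.submatching isM (λ e″ → (e ≟ˢ e″) ⊎-dec (e′ ≟ˢ e″)) L⊆M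

  no-C₄ : (∀ e e′ → e ∈ M → e′ ∈ M → e ≢ e′ →
    IsMatching G (｛ e ｝ ∪ ｛ e′ ｝) × UniquelyRestricted G (｛ e ｝ ∪ ｛ e′ ｝)) →
    ¬ AlternatingCycle G M 4
  no-C₄ restricted C =
    -- The 4-cycle stays alternating for its own two matching edges, so flipping it already refutes
    -- uniqueness for that pair.
    let isL , uniqueL = restricted _ _ ab∈M cd∈M ab≢cd
    in Flip.¬uniquelyRestricted isL
         (record { ab∈M = inj₁ refl ; b~c = b~c ; cd∈M = inj₂ refl ; d~a = d~a ; a≢c = a≢c ; b≢d = b≢d })
         uniqueL
    where
    open AlternatingSquare (cycle⇒square C)
    ab≢cd : pair a b ≢ pair c d
    ab≢cd eq with ∈-pair⁻ (subst (a Subset.∈_) eq ∈-pairˡ)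
    ... | inj₁ a≡c = a≢c a≡c
    ... | inj₂ a≡d = Graph.~-irrefl G (sym a≡d) d~a
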